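{- Let $\Sigma=\{0,1\}$, let $f:\Sigma^*\to\Sigma^*$ be a function, and let $\hat\mu$ be the standard uniform distribution on $\Sigma^*$. Suppose that $\mathcal{A}(x,\delta)$ is a polynomial-time benign algorithm scheme for the distributional problem $f$ on $\hat\mu$. Then there is a frequently self-knowingly correct polynomial-time algorithm $\mathcal{A}'$ for $f$.
   Context: $\Sigma=\{0,1\}$; $\Sigma^*$ is the set of finite strings over $\Sigma$, and $\Sigma^n$ the set of strings of length exactly $n$. $|x|$ is the length of $x$. All algorithms are deterministic. Standard uniform distribution: $\hat\mu$ assigns to each string $x$ with $|x|\ge 1$ the probability weight $\hat\mu'(x)=\frac{1}{|x|(|x|+1)2^{|x|}}$; the empty string has weight zero. (That is, first choose a length $n\ge 1$ with probability $1/(n(n+1))$, then choose a string of length $n$ uniformly at random.) For a distribution $\mu$ on $\Sigma^*$ and $n\in\mathbb{N}^+$, $\mu_{\le n}$ denotes the restriction of $\mu$ to strings of length at most $n$, i.e., $\mu$ conditioned on the drawn string having length at most $n$ (renormalized so that total weight is 1). Benign faults: an algorithm computes a function $f$ with benign faults if on each input it outputs either an element of the image of $f$ or the special symbol "?" (which is not in the image of $f$), and whenever it outputs anything other than "?", its output is correct (equals the value of $f$ on the input). Polynomial-time benign algorithm scheme: for a function $f$ on a distribution $\mu$ on $\Sigma^*$, this is an algorithm $\mathcal{A}(x,\delta)$, taking as input a string $x$ and a (rational) parameter $\delta$ with $0<\delta<1$, such that: (a) $\mathcal{A}$ runs in time polynomial in $|x|$ and $1/\delta$; (b) $\mathcal{A}$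 computes $f$ with benign faults (for each value of $\delta$, as a function of $x$); (c) for each $\delta$ with $0<\delta<1$ and each $n\in\mathbb{N}^+$, $\mathrm{Prob}_{\mu_{\le n}}[\mathcal{A}(x,\delta)=\,?]\le\delta$. Self-knowing correctness: for a function $g:\Sigma^*\to T$, an algorithm $\mathcal{B}:\Sigma^*\to T\times\{\text{"definitely"},\text{"maybe"}\}$ is self-knowingly correct for $g$ if, for each $s\in\Sigma^*$ and $t\in T$, whenever $\mathcal{B}$ on input $s$ outputs $(t,\text{"definitely"})$ then $g(s)=t$. It is frequently self-knowingly correct for $g$ if it is self-knowingly correct for $g$ and $$\lim_{n\to\infty}\frac{\|\{x\in\Sigma^n \mid \mathcal{B}(x)\in T\times\{\text{"maybe"}\}\}\|}{\|\Sigma^n\|}=0,$$ where $\|\cdot\|$ denotes cardinality. A polynomial-time such algorithm is one whose running time is bounded by a polynomial in $|x|$. Here $T=\Sigma^*$. -}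

module Defs where

open import Data.Bool using (Bool; true; false)
open import Data.Fin using (Fin)
open import Data.Integer as ℤ using (+_)
open import Data.List using (List; []; _∷_; _++_; _∷ʳ_; length; map; foldr; concatMap; filterᵇ; applyUpTo; upTo)
open import Data.List.Properties using (length-++; length-map)
open import Data.Maybe using (Maybe; just; nothing; is-nothing)
open import Data.Nat as ℕ using (ℕ; zero; suc)
import Data.Nat.DivMod as ℕ
import Data.Nat.Properties as ℕ
open import Data.Nat.Logarithm using (⌊log₂_⌋)
open import Data.Product using (_×_; _,_; ∃-syntax; proj₂)
open import Data.Rational as ℚ using (ℚ; 0ℚ; 1ℚ)
import Data.Rational.Properties as ℚ
open import Data.Vec as Vec using (Vec; []; _∷_)
open import Function using (const; _∘_)
open import Relation.Binary.PropositionalEquality using (_≡_; refl; sym; trans; cong₂; subst)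

Str : Set
Str = List Bool

strings : ℕ → List Str
strings zero    = [] ∷ []
strings (suc n) = map (false ∷_) (strings n) ++ map (true ∷_) (strings n)

strings≤ : ℕ → List Str
strings≤ n = concatMap strings (upTo (suc n))

length-strings : ∀ n → length (strings n) ≡ 2 ℕ.^ n
length-strings zero    = refl
length-strings (suc n) =
  trans (length-++ (map (false ∷_) (strings n)))
        (cong₂ ℕ._+_ (half false) (trans (half true) (sym (ℕ.+-identityʳ _))))
  where
  half : ∀ b → length (map (b ∷_) (strings n)) ≡ 2 ℕ.^ n
  half b = trans (length-map (b ∷_) (strings n)) (length-strings n)

strings-nonEmpty : ∀ n → ℕ.NonZero (length (strings n))
strings-nonEmpty n = subst ℕ.NonZero (sym (length-strings n)) (ℕ.m^n≢0 2 n)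

------------------------------------------------------------------------
-- Distributions on strings, given by their weight functions

Weight : Set
Weight = Str → ℚ

sumℚ : List ℚ → ℚ
sumℚ = foldr ℚ._+_ 0ℚ

weightOn≤ : Weight → ℕ → (Str → Bool) → ℚ
weightOn≤ μ n P = sumℚ (map μ (filterᵇ P (strings≤ n)))

total≤ : Weight → ℕ → ℚ
total≤ μ n = weightOn≤ μ n (const true)

-- The probability of P under μ conditioned on length at most n.
Prob≤ : (μ : Weight) (n : ℕ) → .{{ℚ.NonZero (total≤ μ n)}} → (Str → Bool) → ℚ
Prob≤ μ n P = weightOn≤ μ n P ℚ.÷ total≤ μ n

lengthWeight : ℕ → ℚ
lengthWeight zero      = 0ℚ
lengthWeight n@(suc _) = + 1 ℚ./ (n ℕ.* suc n ℕ.* 2 ℕ.^ n)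
  where instance _ = ℕ.m*n≢0 (n ℕ.* suc n) (2 ℕ.^ n) {{_}} {{ℕ.m^n≢0 2 n}}

μ̂ : Weight
μ̂ x = lengthWeight (length x)

-- So the condition in Prob≤ is always met by μ̂.
total≤-μ̂ : ∀ n .{{_ : ℕ.NonZero n}} → ℚ.Positive (total≤ μ̂ n)
total≤-μ̂ (suc n) =
  ℚ.nonNeg+pos⇒pos 0ℚ (sumℚ (map μ̂ ((false ∷ []) ∷ rest)))
    {{ℚ.pos+nonNeg⇒pos (μ̂ (false ∷ [])) (sumℚ (map μ̂ rest)) {{nonNeg rest}}}}
  where
  rest : List Str
  rest = (true ∷ []) ∷ filterᵇ (const true) (concatMap strings (applyUpTo (λ i → 2 ℕ.+ i) n))

  weight-nonNeg : ∀ k → ℚ.NonNegative (lengthWeight k)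
  weight-nonNeg zero      = _
  weight-nonNeg k@(suc _) = ℚ.normalize-nonNeg 1 (k ℕ.* suc k ℕ.* 2 ℕ.^ k)
    where instance _ = ℕ.m*n≢0 (k ℕ.* suc k) (2 ℕ.^ k) {{_}} {{ℕ.m^n≢0 2 k}}

  nonNeg : ∀ xs → ℚ.NonNegative (sumℚ (map μ̂ xs))
  nonNeg []       = _
  nonNeg (x ∷ xs) =
    ℚ.nonNeg+nonNeg⇒nonNeg (μ̂ x) {{weight-nonNeg (length x)}} (sumℚ (map μ̂ xs)) {{nonNeg xs}}

------------------------------------------------------------------------
-- Deterministic multitape Turing machines

data Symbol (aux : ℕ) : Set where
  blank : Symbol aux
  bit   : Bool → Symbol aux
  extra : Fin aux → Symbol aux

data Move : Set where
  left stay right : Move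

-- A two-way infinite tape seen from its head; cells beyond either list are
-- blank, and the nearest cell comes first in both lists.
record Tape (aux : ℕ) : Set where
  constructor tape
  field
    before : List (Symbol aux)
    here   : Symbol aux
    after  : List (Symbol aux)

open Tape

module _ {aux : ℕ} where

  fromCells : List (Symbol aux) → Tape aux
  fromCells []       = tape [] blank []
  fromCells (c ∷ cs) = tape [] c cs

  write : Symbol aux → Tape aux → Tape aux
  write s (tape ls _ rs) = tape ls s rs

  move : Move → Tape aux → Tape aux
  move left  (tape []       c rs)       = tape [] blank (c ∷ rs)
  move left  (tape (l ∷ ls) c rs)       = tape ls l (c ∷ rs)
  move stay  t                          = t
  move right (tape ls       c [])       = tape (c ∷ ls) blank []
  move right (tape ls       c (r ∷ rs)) = tape (c ∷ ls) r rs

  leadingBits : List (Symbol aux) → Str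
  leadingBits (bit b ∷ cs) = b ∷ leadingBits cs
  leadingBits _            = []

-- A machine with m inputs has one output tape (the first), m input tapes
-- and some number of work tapes.  It halts when `transition` is undefined.
record Machine (m : ℕ) : Set where
  field
    aux work states : ℕ

  tapes : ℕ
  tapes = suc (m ℕ.+ work)

  field
    start      : Fin states
    transition : Fin states → Vec (Symbol aux) tapes →
                 Maybe (Fin states × Vec (Symbol aux × Move) tapes)

  Config : Set
  Config = Fin states × Vec (Tape aux) tapes

  initial : Vec Str m → Config
  initial xs = start , fromCells [] ∷ (Vec.map (fromCells ∘ map bit) xs Vec.++ Vec.replicate work (fromCells []))

  act : Tape aux → Symbol aux × Move → Tape aux
  act t (s , d) = move d (write s t)

  step : Config → Maybe Config
  step (q , ts) with transition q (Vec.map here ts)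
  ... | nothing          = nothing
  ... | just (q′ , acts) = just (q′ , Vec.zipWith act ts acts)

  -- The output is the bit string starting at the head of the output tape.
  output : Config → Str
  output (_ , t ∷ _) = leadingBits (here t ∷ after t)

  data _⇓[_]_ : Config → ℕ → Str → Set where
    halt : ∀ {c} → step c ≡ nothing → c ⇓[ 0 ] output c
    next : ∀ {c c′ t y} → step c ≡ just c′ → c′ ⇓[ t ] y → c ⇓[ suc t ] y

------------------------------------------------------------------------
-- Polynomial time

data Poly (v : ℕ) : Set where
  con     : ℕ → Poly v
  var     : Fin v → Poly v
  _⊕_ _⊗_ : Poly v → Poly v → Poly v

eval : ∀ {v} → Poly v → Vec ℚ v → ℚ
eval (con c) ρ = + c ℚ./ 1
eval (var i) ρ = Vec.lookup ρ i
eval (p ⊕ q) ρ = eval p ρ ℚ.+ eval q ρ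
eval (p ⊗ q) ρ = eval p ρ ℚ.* eval q ρ

OutputsWithin : ∀ {m} → Machine m → Vec Str m → Str → ℚ → Set
OutputsWithin M xs y bound =
  ∃[ t ] (initial xs ⇓[ t ] y) × (+ t ℚ./ 1 ℚ.≤ bound)
  where open Machine M

∣_∣ℚ : Str → ℚ
∣ x ∣ℚ = + length x ℚ./ 1

------------------------------------------------------------------------
-- Benign algorithm schemes; `nothing` is the symbol "?"

record Parameter : Set where
  field
    δ   : ℚ
    0<δ : 0ℚ ℚ.< δ
    δ<1 : δ ℚ.< 1ℚ

  1/δ : ℚ
  1/δ = (ℚ.1/ δ) {{ℚ.>-nonZero 0<δ}}

open Parameter public using (δ; 1/δ)

-- The w low-order binary digits of n, most significant first.
digits : (w n : ℕ) → Str
digits zero    n = []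
digits (suc w) n = digits w (n ℕ./ 2) ∷ʳ (n ℕ.% 2 ℕ.≡ᵇ 1)

-- δ = p / q in lowest terms is given in binary as p and q on two tapes, p
-- being padded with leading zeros to the width of q.  Time polynomial in |x|
-- and 1/δ need not suffice to read all of p and q; the alignment ensures that
-- their leading O(log (1/δ)) digits determine δ up to a constant factor, so
-- that such a time bound is no undue restriction on a scheme.
encodeParameter : Parameter → Vec Str 2
encodeParameter d = digits width ℤ.∣ ℚ.↥ δ d ∣ ∷ digits width (ℚ.↧ₙ δ d) ∷ []
  where
  width = suc ⌊log₂ ℚ.↧ₙ δ d ⌋

encodeBenign : Maybe Str → Str
encodeBenign nothing  = false ∷ []
encodeBenign (just y) = true ∷ y

record BenignFaults (f : Str → Str) (g : Str → Maybe Str) : Set where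
  field
    inImage : ∀ x y → g x ≡ just y → ∃[ z ] f z ≡ y
    correct : ∀ x y → g x ≡ just y → y ≡ f x

record PolyTimeBenignScheme (f : Str → Str) (μ : Weight)
                            (A : Str → Parameter → Maybe Str) : Set where
  field
    machine   : Machine 3
    timeBound : Poly 2
    runs      : ∀ x d → OutputsWithin machine (x ∷ encodeParameter d) (encodeBenign (A x d))
                                      (eval timeBound (∣ x ∣ℚ ∷ 1/δ d ∷ []))
    benign    : ∀ d → BenignFaults f (λ x → A x d)
    rarely?   : ∀ d n .{{_ : ℕ.NonZero n}} .{{_ : ℚ.NonZero (total≤ μ n)}} →
                Prob≤ μ n (λ x → is-nothing (A x d)) ℚ.≤ δ d

------------------------------------------------------------------------
-- Self-knowing correctness

data Confidence : Set where
  definitely maybe : Confidence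

isMaybe : Confidence → Bool
isMaybe definitely = false
isMaybe maybe      = true

SelfKnowinglyCorrect : {T : Set} → (Str → T) → (Str → T × Confidence) → Set
SelfKnowinglyCorrect g B = ∀ s t → B s ≡ (t , definitely) → g s ≡ t

maybeFraction : {T : Set} → (Str → T × Confidence) → ℕ → ℚ
maybeFraction B n =
  (+ length (filterᵇ (isMaybe ∘ proj₂ ∘ B) (strings n)) ℚ./ length (strings n)) {{strings-nonEmpty n}}

_⟶_ : (ℕ → ℚ) → ℚ → Set
a ⟶ l = ∀ ε → 0ℚ ℚ.< ε → ∃[ N ] ∀ n → N ℕ.≤ n → ℚ.∣ a n ℚ.- l ∣ ℚ.< ε

record FrequentlySelfKnowinglyCorrect {T : Set} (g : Str → T) (B : Str → T × Confidence) : Set where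
  field
    selfKnowing : SelfKnowinglyCorrect g B
    frequently  : maybeFraction B ⟶ 0ℚ

encodeVerdict : Str × Confidence → Str
encodeVerdict (t , maybe)      = false ∷ t
encodeVerdict (t , definitely) = true ∷ t

record PolyTime (B : Str → Str × Confidence) : Set where
  field
    machine   : Machine 1
    timeBound : Poly 1
    runs      : ∀ x → OutputsWithin machine (x ∷ []) (encodeVerdict (B x))
                                    (eval timeBound (∣ x ∣ℚ ∷ []))

{-# OPTIONS --safe #-}
module Submission where

-- On a string x of length n, A′ runs the scheme with δ = 2^-k, where k = 4 (L + 1)
-- and L is the number of halvings that reduce n to 0.  Then (n + 1)^4 ≤ 1/δ ≤ (4 n + 4)^4.
-- A string of length n has weight 1 / (n (n + 1) 2^n) and each length has total
-- weight at most 1, so Prob_{≤ n} [A = ?] ≤ δ bounds the proportion of "?" among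
-- the strings of length n by δ n (n + 1)^2 ≤ 1 / (n + 1).
--
-- The machine for A′ produces the encoding 0^k 1 , 1 0^k of δ as follows.  It
-- copies x in unary to the output tape, then repeatedly sweeps over the copy,
-- erasing every other mark, until no mark is left.  In each round, including the
-- initial copying, it writes four more digits on each of the parameter tapes.
-- The output tape is then blank again and the machine of the scheme takes over.
-- Since the codes of "?" and (ε , maybe) and those of y and (y , definitely)
-- agree, its output needs no translation.

open import Defs
open import Data.Bool using (Bool; true; false)
open import Data.Empty using (⊥-elim)
open import Data.Fin using (Fin; zero; suc)
open import Data.Integer as ℤ using (+_; +[1+_])
import Data.Integer.Properties as ℤ
open import Data.List
  using (List; []; _∷_; _∷ʳ_; _++_; _ʳ++_; length; map; replicate; filterᵇ; concatMap; upTo)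
open import Data.List.Properties
  using (length-map; length-ʳ++; length-upTo; map-++; map-∘; map-id; filter-++; ʳ++-ʳ++; ++-identityʳ)
open import Data.List.Membership.Propositional using (_∈_)
open import Data.List.Membership.Propositional.Properties using (∈-upTo⁺)
open import Data.List.Relation.Unary.All as All using (All; []; _∷_)
open import Data.List.Relation.Unary.All.Properties using (map⁺; ++⁺)
open import Data.List.Relation.Unary.Any using (here; there)
open import Data.Maybe as Maybe using (Maybe; just; nothing; is-nothing)
open import Data.Nat as ℕ using (ℕ; zero; suc; _+_; _*_; _^_; _≤_; _<_; ⌊_/2⌋; pred)
import Data.Nat.DivMod as ℕ
import Data.Nat.Properties as ℕ
open import Data.Nat.Coprimality using (1-coprimeTo) renaming (sym to coprime-sym)
open import Data.Nat.Induction using (<-rec)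
open import Data.Nat.Logarithm using (⌊log₂_⌋; ⌊log₂[2^n]⌋≡n)
open import Data.Nat.Solver using (module +-*-Solver)
open import Data.Product using (_×_; _,_; proj₁; proj₂; map₁; ∃-syntax)
open import Data.Rational as ℚ using (ℚ; mkℚ; 0ℚ; 1ℚ)
import Data.Rational.Properties as ℚ
open import Data.Rational.Solver renaming (module +-*-Solver to ℚ-Solver)
import Data.Rational.Unnormalised as ℚᵘ
import Data.Rational.Unnormalised.Properties as ℚᵘ
open import Data.Vec as Vec using (Vec; []; _∷_)
open import Data.Vec.Properties using (lookup-map)
open import Data.Vec.Relation.Binary.Pointwise.Inductive as Pointwise using (Pointwise; []; _∷_)
open import Function using (const; _∘_)
open import Relation.Binary.PropositionalEquality
  using (_≡_; _≢_; refl; sym; trans; cong; cong₂; subst; subst₂; module ≡-Reasoning)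
open import Relation.Nullary.Decidable using (T?)

-- Tapes up to blanks at their ends

module _ {aux : ℕ} where

  cell : List (Symbol aux) → ℕ → Symbol aux
  cell []       _       = blank
  cell (c ∷ _)  zero    = c
  cell (_ ∷ cs) (suc i) = cell cs i

  infix 4 _≋_ _≈_
  infix 3 _⨟_

  _≋_ : List (Symbol aux) → List (Symbol aux) → Set
  cs ≋ ds = ∀ i → cell cs i ≡ cell ds i

  ∷-≋ : ∀ {c d cs ds} → c ≡ d → cs ≋ ds → c ∷ cs ≋ d ∷ ds
  ∷-≋ c≡d cs≋ds zero    = c≡d
  ∷-≋ c≡d cs≋ds (suc i) = cs≋ds i

  blank-≋ : blank ∷ [] ≋ []
  blank-≋ zero    = refl
  blank-≋ (suc i) = refl

  -- Reading stops at the first cell that is not a bit, and a missing cell counts as a blank, so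
  -- blanks at the end cannot affect the output.
  leadingBits-≋ : ∀ cs ds → cs ≋ ds → leadingBits cs ≡ leadingBits ds
  leadingBits-≋ []            []            eq = refl
  leadingBits-≋ []            (blank ∷ _)   eq = refl
  leadingBits-≋ []            (extra _ ∷ _) eq = refl
  leadingBits-≋ []            (bit _ ∷ _)   eq with () ← eq 0
  leadingBits-≋ (blank ∷ _)   []            eq = refl
  leadingBits-≋ (extra _ ∷ _) []            eq = refl
  leadingBits-≋ (bit _ ∷ _)   []            eq with () ← eq 0
  leadingBits-≋ (c ∷ cs)      (d ∷ ds)      eq with c | d | eq 0
  ... | blank   | _ | refl = refl
  ... | extra _ | _ | refl = refl
  ... | bit b   | _ | refl = cong (b ∷_) (leadingBits-≋ cs ds (eq ∘ suc))

  contents : Tape aux → List (Symbol aux)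
  contents t = Tape.here t ∷ Tape.after t

  -- Equality up to the blanks stored at the two ends of the representation.
  record _≈_ (t u : Tape aux) : Set where
    constructor _⨟_
    field
      before-≋   : Tape.before t ≋ Tape.before u
      contents-≋ : contents t ≋ contents u

  ≈-refl : ∀ {t} → t ≈ t
  ≈-refl = (λ _ → refl) ⨟ (λ _ → refl)

  ≈-reflexive : ∀ {t u} → t ≡ u → t ≈ u
  ≈-reflexive refl = ≈-refl

  ≈-sym : ∀ {t u} → t ≈ u → u ≈ t
  ≈-sym (p ⨟ q) = sym ∘ p ⨟ sym ∘ q

  ≈-trans : ∀ {t u v} → t ≈ u → u ≈ v → t ≈ v
  ≈-trans (p ⨟ q) (p′ ⨟ q′) = (λ i → trans (p i) (p′ i)) ⨟ (λ i → trans (q i) (q′ i))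

  before-left : ∀ t i → cell (Tape.before (move left t)) i ≡ cell (Tape.before t) (suc i)
  before-left (tape []      _ _) i = refl
  before-left (tape (_ ∷ _) _ _) i = refl

  contents-left : ∀ t → contents (move left t) ≋ cell (Tape.before t) 0 ∷ contents t
  contents-left (tape []      _ _) i = refl
  contents-left (tape (_ ∷ _) _ _) i = refl

  before-right : ∀ t → Tape.before (move right t) ≋ Tape.here t ∷ Tape.before t
  before-right (tape _ _ [])      i = refl
  before-right (tape _ _ (_ ∷ _)) i = refl

  contents-right : ∀ t → contents (move right t) ≋ Tape.after t
  contents-right (tape _ _ [])      = blank-≋
  contents-right (tape _ _ (_ ∷ _)) = λ _ → refl

  move-≈ : ∀ d {t u} → t ≈ u → move d t ≈ move d u
  move-≈ left  {t} {u} (p ⨟ q) =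
    (λ i → trans (before-left t i) (trans (p (suc i)) (sym (before-left u i)))) ⨟
    (λ i → trans (contents-left t i) (trans (∷-≋ (p 0) q i) (sym (contents-left u i))))
  move-≈ stay  eq = eq
  move-≈ right {t} {u} (p ⨟ q) =
    (λ i → trans (before-right t i) (trans (∷-≋ (q 0) p i) (sym (before-right u i)))) ⨟
    (λ i → trans (contents-right t i) (trans (q (suc i)) (sym (contents-right u i))))

  write-≈ : ∀ s {t u} → t ≈ u → write s t ≈ write s u
  write-≈ s (p ⨟ q) = p ⨟ ∷-≋ refl (q ∘ suc)

  infix 4 _≈*_

  _≈*_ : ∀ {k} → Vec (Tape aux) k → Vec (Tape aux) k → Set
  _≈*_ = Pointwise _≈_

  ≈*-refl : ∀ {k} {ts : Vec (Tape aux) k} → ts ≈* ts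
  ≈*-refl = Pointwise.refl ≈-refl

  here-≈* : ∀ {k} {ts us : Vec (Tape aux) k} → ts ≈* us → Vec.map Tape.here ts ≡ Vec.map Tape.here us
  here-≈* []               = refl
  here-≈* ((_ ⨟ q) ∷ rest) = cong₂ _∷_ (q 0) (here-≈* rest)

  -- at ls rs has its head on the first cell of rs, to ls rs on the first
  -- cell of ls.
  at to : List (Symbol aux) → List (Symbol aux) → Tape aux
  at ls []       = tape ls blank []
  at ls (r ∷ rs) = tape ls r rs
  to []       rs = tape [] blank rs
  to (l ∷ ls) rs = tape ls l rs

  fromCells-at : ∀ cs → fromCells cs ≡ at [] cs
  fromCells-at []      = refl
  fromCells-at (_ ∷ _) = refl

  at-≋ : ∀ {ls cs ds} → cs ≋ ds → at ls cs ≈ at ls ds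
  at-≋ {ls} {cs} {ds} eq =
    (λ i → cong (λ c → cell c i) (trans (before-at cs) (sym (before-at ds)))) ⨟
    (λ i → trans (contents-at cs i) (trans (eq i) (sym (contents-at ds i))))
    where
    before-at : ∀ cs → Tape.before (at ls cs) ≡ ls
    before-at []      = refl
    before-at (_ ∷ _) = refl
    contents-at : ∀ cs → contents (at ls cs) ≋ cs
    contents-at []      = blank-≋
    contents-at (_ ∷ _) = λ _ → refl

  right-at : ∀ {s} ls cs → move right (tape ls s cs) ≈ at (s ∷ ls) cs
  right-at ls []      = ≈-refl
  right-at ls (_ ∷ _) = ≈-refl

  left-at : ∀ ls → move left (tape ls blank []) ≈ to ls []
  left-at []      = (λ _ → refl) ⨟ ∷-≋ refl blank-≋
  left-at (_ ∷ _) = (λ _ → refl) ⨟ ∷-≋ refl blank-≋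

  left-to : ∀ {s} ls rs → move left (tape ls s rs) ≈ to ls (s ∷ rs)
  left-to []      rs = ≈-refl
  left-to (_ ∷ _) rs = ≈-refl

  -- Stepping back onto the input leaves the visited blank stored on the left, so the two sides
  -- agree only up to `≈`.
  right-to : ∀ rs → move right (tape [] blank rs) ≈ at [] rs
  right-to []      = blank-≋ ⨟ (λ _ → refl)
  right-to (_ ∷ _) = blank-≋ ⨟ (λ _ → refl)

  idle : ∀ {k} → Vec (Symbol aux) k → Vec (Symbol aux × Move) k
  idle = Vec.map (_, stay)

-- Runs of a machine up to equivalence of tapes

module Run {m} (M : Machine m) where
  open Machine M

  infix 4 _≈ᶜ_ _↝[_]_

  _≈ᶜ_ : Config → Config → Set
  (p , ts) ≈ᶜ (q , us) = p ≡ q × ts ≈* us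

  ≈ᶜ-sym : ∀ {c d} → c ≈ᶜ d → d ≈ᶜ c
  ≈ᶜ-sym (p≡q , ts≈us) = sym p≡q , Pointwise.sym ≈-sym ts≈us

  ≈ᶜ-trans : ∀ {c d e} → c ≈ᶜ d → d ≈ᶜ e → c ≈ᶜ e
  ≈ᶜ-trans (p≡q , ts≈us) (q≡r , us≈vs) = trans p≡q q≡r , Pointwise.trans ≈-trans ts≈us us≈vs

  act* : ∀ {k} → Vec (Tape aux) k → Vec (Symbol aux × Move) k → Vec (Tape aux) k
  act* = Vec.zipWith act

  act*-≈ : ∀ {k} {ts us : Vec (Tape aux) k} as → ts ≈* us → act* ts as ≈* act* us as
  act*-≈ []             []             = []
  act*-≈ ((s , d) ∷ as) (t≈u ∷ ts≈us) = move-≈ d (write-≈ s t≈u) ∷ act*-≈ as ts≈us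

  act*-idle : ∀ {k} (ts : Vec (Tape aux) k) → act* ts (idle (Vec.map Tape.here ts)) ≡ ts
  act*-idle []       = refl
  act*-idle (t ∷ ts) = cong (t ∷_) (act*-idle ts)

  step-transition : ∀ q ts →
    step (q , ts) ≡ Maybe.map (λ (q′ , as) → q′ , act* ts as) (transition q (Vec.map Tape.here ts))
  step-transition q ts with transition q (Vec.map Tape.here ts)
  ... | nothing = refl
  ... | just _  = refl

  step-≈-nothing : ∀ {c d} → c ≈ᶜ d → step c ≡ nothing → step d ≡ nothing
  step-≈-nothing {q , ts} {_ , us} (refl , ts≈us) eq
    rewrite step-transition q ts | step-transition q us | here-≈* ts≈us
    with nothing ← transition q (Vec.map Tape.here us) = refl

  -- Equivalent tapes show the same symbols under their heads, so the same transition applies, and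
  -- moving and writing preserve `≈`.
  step-≈-just : ∀ {c c′ d} → c ≈ᶜ d → step c ≡ just c′ → ∃[ d′ ] step d ≡ just d′ × c′ ≈ᶜ d′
  step-≈-just {q , ts} {_} {_ , us} (refl , ts≈us) eq
    rewrite step-transition q ts | step-transition q us | here-≈* ts≈us
    with just (_ , as) ← transition q (Vec.map Tape.here us) | refl ← eq
    = _ , refl , refl , act*-≈ as ts≈us

  output-≈ : ∀ {c d} → c ≈ᶜ d → output c ≡ output d
  output-≈ {_ , t ∷ _} {_ , u ∷ _} (_ , (_ ⨟ q) ∷ _) = leadingBits-≋ (contents t) (contents u) q

  ⇓-≈ : ∀ {c d t y} → c ≈ᶜ d → d ⇓[ t ] y → c ⇓[ t ] y
  ⇓-≈ {c} c≈d (halt stuck) =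
    subst (c ⇓[ 0 ]_) (output-≈ c≈d) (halt (step-≈-nothing (≈ᶜ-sym c≈d) stuck))
  ⇓-≈ c≈d (next d→d′ rest) with step-≈-just (≈ᶜ-sym c≈d) d→d′
  ... | _ , c→c′ , d′≈c′ = next c→c′ (⇓-≈ (≈ᶜ-sym d′≈c′) rest)

  -- The end point is fixed only up to `≈ᶜ`. Sweeps can then be stated with tapes in a standard form
  -- and still be chained with exact step counts.
  data _↝[_]_ : Config → ℕ → Config → Set where
    done : ∀ {c d} → c ≈ᶜ d → c ↝[ 0 ] d
    more : ∀ {c c′ d t} → step c ≡ just c′ → c′ ↝[ t ] d → c ↝[ suc t ] d

  ↝-≈ : ∀ {c d e t} → c ≈ᶜ d → d ↝[ t ] e → c ↝[ t ] e
  ↝-≈ c≈d (done d≈e)        = done (≈ᶜ-trans c≈d d≈e)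
  ↝-≈ c≈d (more d→d′ rest) with step-≈-just (≈ᶜ-sym c≈d) d→d′
  ... | _ , c→c′ , d′≈c′ = more c→c′ (↝-≈ (≈ᶜ-sym d′≈c′) rest)

  infixr 5 _▷_ _▷⇓_

  _▷_ : ∀ {c d e s t} → c ↝[ s ] d → d ↝[ t ] e → c ↝[ s + t ] e
  done c≈d       ▷ rest = ↝-≈ c≈d rest
  more c→c′ run ▷ rest = more c→c′ (run ▷ rest)

  _▷⇓_ : ∀ {c d s t y} → c ↝[ s ] d → d ⇓[ t ] y → c ⇓[ s + t ] y
  done c≈d       ▷⇓ rest = ⇓-≈ c≈d rest
  more c→c′ run ▷⇓ rest = next c→c′ (run ▷⇓ rest)

  recount : ∀ {c d s t} → s ≡ t → c ↝[ s ] d → c ↝[ t ] d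
  recount refl run = run

  retarget : ∀ {c d e t} → d ≡ e → c ↝[ t ] d → c ↝[ t ] e
  retarget refl run = run

  once : ∀ {c c′ d} → step c ≡ just c′ → c′ ≈ᶜ d → c ↝[ 1 ] d
  once c→c′ c′≈d = more c→c′ (done c′≈d)

-- Marked cells and the effect of a sweep

-- The bits of the input, each with a flag telling whether the cell next to it
-- on the output tape carries a mark.
Cells : Set
Cells = List (Bool × Bool)

marks : Cells → ℕ
marks []                = 0
marks ((_ , false) ∷ R) = marks R
marks ((_ , true)  ∷ R) = suc (marks R)

-- The marks passed in the current sweep: none, or an odd or positive even number.
data Seen : Set where
  none odd even : Seen

after : Seen → Cells → Seen
after s    []                = s
after s    ((_ , false) ∷ R) = after s R
after none ((_ , true)  ∷ R) = after odd R
after odd  ((_ , true)  ∷ R) = after even R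
after even ((_ , true)  ∷ R) = after odd R

-- The first, third, fifth mark and so on are erased, so that an odd count is rounded down. On marks
-- `none` acts as `even` does; the two are kept apart to tell at the end of a sweep whether there
-- was any mark.
halve : Seen → Cells → Cells
halve s    []                = []
halve s    ((b , false) ∷ R) = (b , false) ∷ halve s R
halve none ((b , true)  ∷ R) = (b , false) ∷ halve odd R
halve odd  ((b , true)  ∷ R) = (b , true)  ∷ halve even R
halve even ((b , true)  ∷ R) = (b , false) ∷ halve odd R

-- After an odd number of marks the next one survives and the count rounds up; after an even number
-- it is erased and the count rounds down. Each mark passed swaps the two cases, whence the mutual
-- induction.
marks-halve-odd  : ∀ R → marks (halve odd R) ≡ ⌊ suc (marks R) /2⌋
marks-halve-even : ∀ R → marks (halve even R) ≡ ⌊ marks R /2⌋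
marks-halve-odd  []                = refl
marks-halve-odd  ((_ , false) ∷ R) = marks-halve-odd R
marks-halve-odd  ((_ , true)  ∷ R) = cong suc (marks-halve-even R)
marks-halve-even []                = refl
marks-halve-even ((_ , false) ∷ R) = marks-halve-even R
marks-halve-even ((_ , true)  ∷ R) = marks-halve-odd R

marks-halve-none : ∀ R → marks (halve none R) ≡ ⌊ marks R /2⌋
marks-halve-none []                = refl
marks-halve-none ((_ , false) ∷ R) = marks-halve-none R
marks-halve-none ((_ , true)  ∷ R) = marks-halve-odd R

bits-halve : ∀ s R → map proj₁ (halve s R) ≡ map proj₁ R
bits-halve s    []                = refl
bits-halve s    ((b , false) ∷ R) = cong (b ∷_) (bits-halve s R)
bits-halve none ((b , true)  ∷ R) = cong (b ∷_) (bits-halve odd R)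
bits-halve odd  ((b , true)  ∷ R) = cong (b ∷_) (bits-halve even R)
bits-halve even ((b , true)  ∷ R) = cong (b ∷_) (bits-halve odd R)

after-odd≢none  : ∀ R → after odd R ≢ none
after-even≢none : ∀ R → after even R ≢ none
after-odd≢none  ((_ , false) ∷ R) = after-odd≢none R
after-odd≢none  ((_ , true)  ∷ R) = after-even≢none R
after-even≢none ((_ , false) ∷ R) = after-even≢none R
after-even≢none ((_ , true)  ∷ R) = after-odd≢none R

-- The first mark leads to `odd`, and from then on the state only alternates between `odd` and
-- `even`.
after-marked : ∀ R {m} → marks R ≡ suc m → after none R ≢ none
after-marked ((_ , false) ∷ R) eq = after-marked R eq
after-marked ((_ , true)  ∷ R) eq = after-odd≢none R

-- A sweep to the right stacks the cells in reverse order on the left of the head; the sweep back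
-- restores their order.
ʳ++-involutive : {A : Set} (zs : List A) → (zs ʳ++ []) ʳ++ [] ≡ zs
ʳ++-involutive zs = trans (ʳ++-ʳ++ zs) (++-identityʳ zs)

length-bits : ∀ {x} (R : Cells) → map proj₁ R ≡ x → length R ≡ length x
length-bits R refl = sym (length-map proj₁ R)

after-unmarked : ∀ R → marks R ≡ 0 → after none R ≡ none
after-unmarked []                eq = refl
after-unmarked ((_ , false) ∷ R) eq = after-unmarked R eq

-- `L` is the binary length of `m`. A derivation has one constructor `suc` per round of the machine,
-- so the rounds can be handled by structural recursion.
data Halvings : ℕ → ℕ → Set where
  zero : Halvings 0 0
  suc  : ∀ {m L} → Halvings ⌊ suc m /2⌋ L → Halvings (suc m) (suc L)

-- A round takes `n` steps to the right, `n` steps back and four steps at the ends; the final sweep,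
-- which finds no mark, has only two steps at the ends. The initial copying costs as much as a
-- round.
setUpTime : ℕ → ℕ → ℕ
setUpTime n zero    = n + (2 + n)
setUpTime n (suc L) = (n + (4 + n)) + setUpTime n L

-- The machine that writes the parameter and then runs the scheme

pattern copy    = zero
pattern turn₁   = suc zero
pattern turn₂   = suc (suc zero)
pattern back    = suc (suc (suc zero))
pattern scan₀   = suc (suc (suc (suc zero)))
pattern scan₁   = suc (suc (suc (suc (suc zero))))
pattern scan₂   = suc (suc (suc (suc (suc (suc zero)))))
pattern return  = suc (suc (suc (suc (suc (suc (suc zero))))))
pattern run q   = suc (suc (suc (suc (suc (suc (suc (suc q)))))))

module Wrapper (M : Machine 3) where
  open Machine M using (aux; work; states; start; transition)

  S : Set
  S = Symbol aux

  -- An absent mark is a blank, so erasing all marks leaves the output tape as the scheme expects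
  -- it.
  mark : Bool → S
  mark false = blank
  mark true  = bit true

  sweep : ∀ {k} → Fin (8 + states) → S → S → Move → S × Move → S × Move → Vec S k →
          Maybe (Fin (8 + states) × Vec (S × Move) (4 + k))
  sweep q o x d u v ws = just (q , (o , d) ∷ (x , d) ∷ u ∷ v ∷ idle ws)

  -- The parameter tapes are written from right to left.
  padding : S × Move
  padding = bit false , left

  -- The tapes are: output (o), input (x), numerator (u), denominator (v), work (ws).
  delta : Fin (8 + states) → Vec S (4 + work) → Maybe (Fin (8 + states) × Vec (S × Move) (4 + work))
  delta copy   (o ∷ bit b ∷ u ∷ v ∷ ws) = sweep copy (bit true) (bit b) right (u , stay) (v , stay) ws
  delta copy   (o ∷ x ∷ u ∷ v ∷ ws)     = sweep turn₁ blank blank left (bit true , left) padding ws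
  delta turn₁  (o ∷ x ∷ u ∷ v ∷ ws)     = sweep turn₂ o x stay padding padding ws
  delta turn₂  (o ∷ x ∷ u ∷ v ∷ ws)     = sweep back o x stay padding padding ws
  delta back   (o ∷ bit b ∷ u ∷ v ∷ ws) = sweep back o (bit b) left (u , stay) (v , stay) ws
  delta back   (o ∷ x ∷ u ∷ v ∷ ws)     = sweep scan₀ blank blank right padding padding ws
  delta scan₀  (blank ∷ bit b ∷ u ∷ v ∷ ws) = sweep scan₀ blank (bit b) right (u , stay) (v , stay) ws
  delta scan₀  (o ∷ bit b ∷ u ∷ v ∷ ws) = sweep scan₁ blank (bit b) right (u , stay) (v , stay) ws
  delta scan₀  (o ∷ x ∷ u ∷ v ∷ ws)     = sweep return blank blank left (u , stay) (v , stay) ws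
  delta scan₁  (blank ∷ bit b ∷ u ∷ v ∷ ws) = sweep scan₁ blank (bit b) right (u , stay) (v , stay) ws
  delta scan₁  (o ∷ bit b ∷ u ∷ v ∷ ws) = sweep scan₂ o (bit b) right (u , stay) (v , stay) ws
  delta scan₁  (o ∷ x ∷ u ∷ v ∷ ws)     = sweep turn₁ blank blank left padding padding ws
  delta scan₂  (blank ∷ bit b ∷ u ∷ v ∷ ws) = sweep scan₂ blank (bit b) right (u , stay) (v , stay) ws
  delta scan₂  (o ∷ bit b ∷ u ∷ v ∷ ws) = sweep scan₁ blank (bit b) right (u , stay) (v , stay) ws
  delta scan₂  (o ∷ x ∷ u ∷ v ∷ ws)     = sweep turn₁ blank blank left padding padding ws
  delta return (o ∷ bit b ∷ u ∷ v ∷ ws) = sweep return o (bit b) left (u , stay) (v , stay) ws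
  delta return (o ∷ x ∷ u ∷ v ∷ ws)     = sweep (run start) blank blank right (bit false , stay) (bit true , stay) ws
  delta (run q) ss                      = Maybe.map (map₁ run) (transition q ss)

  -- The two parameter inputs of `M` become the first two work tapes, so both machines have the same
  -- `4 + work` tapes in the same order and a configuration of `M` needs no rearrangement.
  machine : Machine 1
  machine = record
    { aux = aux ; work = 2 + work ; states = 8 + states ; start = copy ; transition = delta }

  open Machine machine using (Config; initial; step; _⇓[_]_; halt; next)
  open Run machine
  module N = Machine M

  lift : N.Config → Config
  lift (q , ts) = run q , ts

  step-lift : ∀ c → step (lift c) ≡ Maybe.map lift (N.step c)
  step-lift (q , ts) with transition q (Vec.map Tape.here ts)
  ... | nothing = refl
  ... | just _  = refl

  ⇓-lift : ∀ {c t y} → c N.⇓[ t ] y → lift c ⇓[ t ] y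
  ⇓-lift (N.halt {c@(_ , _ ∷ _)} stuck) = halt (trans (step-lift c) (cong (Maybe.map lift) stuck))
  ⇓-lift (N.next {c} c→c′ rest) = next (trans (step-lift c) (cong (Maybe.map lift) c→c′)) (⇓-lift rest)

  os xs : Cells → List S
  os = map (mark ∘ proj₂)
  xs = map (bit ∘ proj₁)

  ws : Vec (Tape aux) work
  ws = Vec.replicate work (fromCells [])

  conf : Fin (8 + states) → Tape aux → Tape aux → Tape aux → Tape aux → Config
  conf q o x u v = q , o ∷ x ∷ u ∷ v ∷ ws

  swept : ∀ {q c o x u v o′ x′} →
          step c ≡ just (q , o ∷ x ∷ u ∷ v ∷ act* ws (idle (Vec.map Tape.here ws))) →
          o ≈ o′ → x ≈ x′ → c ↝[ 1 ] conf q o′ x′ u v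
  swept eq o≈o′ x≈x′ =
    once eq (refl , o≈o′ ∷ x≈x′ ∷ ≈-refl ∷ ≈-refl ∷ subst (_≈* ws) (sym (act*-idle ws)) ≈*-refl)

  scan : Seen → Fin (8 + states)
  scan none = scan₀
  scan odd  = scan₁
  scan even = scan₂

  -- The heads on the output and input tapes move together, so a single pair of lists describes both
  -- tapes.
  atᶜ toᶜ : Fin (8 + states) → Cells → Cells → Tape aux → Tape aux → Config
  atᶜ q L R = conf q (at (os L) (os R)) (at (xs L) (xs R))
  toᶜ q L R = conf q (to (os L) (os R)) (to (xs L) (xs R))

  copying : ∀ x L {u v} →
    conf copy (at (os L) []) (at (xs L) (map bit x)) u v ↝[ length x ]
    atᶜ copy (map (_, true) x ʳ++ L) [] u v
  copying []      L = done (refl , ≈*-refl)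
  copying (b ∷ x) L =
    swept refl ≈-refl (right-at (xs L) (map bit x)) ▷
    copying x ((b , true) ∷ L)

  scanning : ∀ s L R {u v} →
    atᶜ (scan s) L R u v ↝[ length R ] atᶜ (scan (after s R)) (halve s R ʳ++ L) [] u v
  scanning s    L []                = done (refl , ≈*-refl)
  scanning none L ((b , false) ∷ R) = swept refl (right-at (os L) (os R)) (right-at (xs L) (xs R)) ▷ scanning none _ R
  scanning none L ((b , true)  ∷ R) = swept refl (right-at (os L) (os R)) (right-at (xs L) (xs R)) ▷ scanning odd _ R
  scanning odd  L ((b , false) ∷ R) = swept refl (right-at (os L) (os R)) (right-at (xs L) (xs R)) ▷ scanning odd _ R
  scanning odd  L ((b , true)  ∷ R) = swept refl (right-at (os L) (os R)) (right-at (xs L) (xs R)) ▷ scanning even _ R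
  scanning even L ((b , false) ∷ R) = swept refl (right-at (os L) (os R)) (right-at (xs L) (xs R)) ▷ scanning even _ R
  scanning even L ((b , true)  ∷ R) = swept refl (right-at (os L) (os R)) (right-at (xs L) (xs R)) ▷ scanning odd _ R

  -- The unfinished numerator and denominator, with the head on the blank to the left of the digits
  -- written so far. The leading 1 of the denominator is still missing, as it is written last.
  zeros≤one one≤zeros : ℕ → Tape aux
  zeros≤one i = tape [] blank (map bit (replicate i false ++ true ∷ []))
  one≤zeros j = tape [] blank (map bit (replicate j false))

  backing : ∀ L R {u v} → toᶜ back L R u v ↝[ length L ] toᶜ back [] (L ʳ++ R) u v
  backing []      R = done (refl , ≈*-refl)
  backing (_ ∷ L) R = swept refl (left-to (os L) (os R)) (left-to (xs L) (xs R)) ▷ backing L _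

  returning : ∀ L R {u v} → toᶜ return L R u v ↝[ length L ] toᶜ return [] (L ʳ++ R) u v
  returning []      R = done (refl , ≈*-refl)
  returning (_ ∷ L) R = swept refl (left-to (os L) (os R)) (left-to (xs L) (xs R)) ▷ returning L _

  -- Three of the four digits of a round are written here: two in the turning states and one on the
  -- blank to the left of the input.
  turning : ∀ L {x i j} → map proj₁ (L ʳ++ []) ≡ x →
    toᶜ turn₁ L [] (zeros≤one i) (one≤zeros j) ↝[ 3 + length x ]
    atᶜ scan₀ [] (L ʳ++ []) (zeros≤one (3 + i)) (one≤zeros (3 + j))
  turning L refl =
    recount time
      (swept refl ≈-refl ≈-refl ▷ swept refl ≈-refl ≈-refl ▷ backing L [] ▷
       swept refl (right-to (os R)) (right-to (xs R)))
    where
    R = L ʳ++ []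
    time : 2 + (length L + 1) ≡ 3 + length (map proj₁ R)
    time = cong (λ l → 2 + l) (begin
      length L + 1             ≡⟨ ℕ.+-comm (length L) 1 ⟩
      suc (length L)           ≡⟨ cong suc (ℕ.+-identityʳ (length L)) ⟨
      suc (length L + 0)       ≡⟨ cong suc (length-ʳ++ L) ⟨
      suc (length R)           ≡⟨ cong suc (length-bits R refl) ⟩
      suc (length (map proj₁ R)) ∎)
      where open ≡-Reasoning

  -- As there is a mark, the scan ends in `scan₁` or `scan₂`. The step at the right end then writes
  -- the first of the four digits, and `turning` the other three.
  pass : ∀ {x m i j} R → map proj₁ R ≡ x → marks R ≡ suc m →
    atᶜ scan₀ [] R (zeros≤one i) (one≤zeros j) ↝[ length x + (4 + length x) ]
    atᶜ scan₀ [] (halve none R) (zeros≤one (4 + i)) (one≤zeros (4 + j))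
  pass {x} {i = i} {j} R R≡x R-marked =
    recount (length-bits R R≡x) (scanning none [] R) ▷
    turn (after none R) (after-marked R R-marked) ▷
    retarget (cong (λ H → atᶜ scan₀ [] H _ _) (ʳ++-involutive (halve none R)))
      (turning L {i = suc i} (trans (cong (map proj₁) (ʳ++-involutive (halve none R))) (trans (bits-halve none R) R≡x)))
    where
    L = halve none R ʳ++ []
    turn : ∀ s → s ≢ none → atᶜ (scan s) L [] (zeros≤one i) (one≤zeros j) ↝[ 1 ]
                             toᶜ turn₁ L [] (zeros≤one (suc i)) (one≤zeros (suc j))
    turn none s≢none = ⊥-elim (s≢none refl)
    turn odd  _      = swept refl (left-at (os L)) (left-at (xs L))
    turn even _      = swept refl (left-at (os L)) (left-at (xs L))

  -- Without marks the output tape is blank up to `≈`. The step into the start state of `M` writes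
  -- the last 0 of the numerator and the leading 1 of the denominator, and leaves the heads on the
  -- first cells.
  finish : ∀ {x i j} R → map proj₁ R ≡ x → marks R ≡ 0 →
    atᶜ scan₀ [] R (zeros≤one i) (one≤zeros j) ↝[ length x + (2 + length x) ]
    lift (N.initial (x ∷ (replicate (suc i) false ++ true ∷ []) ∷ (true ∷ replicate j false) ∷ []))
  finish {x} {i} {j} R R≡x R-unmarked =
    recount (length-bits R R≡x)
      (retarget (cong (λ s → atᶜ (scan s) L [] (zeros≤one i) (one≤zeros j)) (after-unmarked R R-unmarked))
        (scanning none [] R)) ▷
    recount time
      (swept refl (left-at (os L)) (left-at (xs L)) ▷ returning L [] ▷
       swept refl (≈-trans (right-to (os R′)) (at-≋ {ds = []} (unmarked-≋ R′ R′-unmarked)))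
                  (≈-trans (right-to (xs R′)) (≈-reflexive xs-R′)))
    where
    L  = halve none R ʳ++ []
    R′ = L ʳ++ []

    R′≡ : R′ ≡ halve none R
    R′≡ = ʳ++-involutive (halve none R)

    R′≡x : map proj₁ R′ ≡ x
    R′≡x = trans (cong (map proj₁) R′≡) (trans (bits-halve none R) R≡x)

    R′-unmarked : marks R′ ≡ 0
    R′-unmarked = trans (cong marks R′≡) (trans (marks-halve-none R) (cong ⌊_/2⌋ R-unmarked))

    xs-R′ : at [] (xs R′) ≡ fromCells (map bit x)
    xs-R′ = trans (cong (at []) (trans (map-∘ R′) (cong (map bit) R′≡x))) (sym (fromCells-at (map bit x)))

    unmarked-≋ : ∀ R → marks R ≡ 0 → os R ≋ []
    unmarked-≋ []                _  i       = refl
    unmarked-≋ ((_ , false) ∷ R) eq zero    = refl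
    unmarked-≋ ((_ , false) ∷ R) eq (suc i) = unmarked-≋ R eq i

    time : 1 + (length L + 1) ≡ 2 + length x
    time = cong suc (begin
      length L + 1       ≡⟨ ℕ.+-comm (length L) 1 ⟩
      suc (length L)     ≡⟨ cong suc (ℕ.+-identityʳ (length L)) ⟨
      suc (length L + 0) ≡⟨ cong suc (length-ʳ++ L) ⟨
      suc (length R′)    ≡⟨ cong suc (length-bits R′ R′≡x) ⟩
      suc (length x)     ∎)
      where open ≡-Reasoning

  reciprocal : ℕ → Vec Str 2
  reciprocal k = (replicate k false ++ true ∷ []) ∷ (true ∷ replicate k false) ∷ []

  -- Induction on the rounds. The numerator has one zero fewer than the denominator throughout,
  -- because its first written digit is the 1; `finish` makes up for it.
  halving : ∀ {x L i} R → map proj₁ R ≡ x → Halvings (marks R) L →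
    atᶜ scan₀ [] R (zeros≤one (3 + i)) (one≤zeros (4 + i)) ↝[ setUpTime (length x) L ]
    lift (N.initial (x ∷ reciprocal (4 + (L * 4 + i))))
  halving {x} {i = i} R R≡x h with marks R in eq | h
  ... | zero  | zero      = finish {i = 3 + i} R R≡x eq
  ... | suc m | suc {L = L} h′ =
    pass {i = 3 + i} R R≡x eq ▷
    retarget (cong (λ k → lift (N.initial (x ∷ reciprocal (4 + k)))) exponent)
      (halving (halve none R) (trans (bits-halve none R) R≡x)
        (subst (λ m → Halvings m L) (sym (trans (marks-halve-none R) (cong ⌊_/2⌋ eq))) h′))
    where
    exponent : L * 4 + (4 + i) ≡ 4 + (L * 4 + i)
    exponent = trans (sym (ℕ.+-assoc (L * 4) 4 i)) (cong (_+ i) (ℕ.+-comm (L * 4) 4))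

  setUp : ∀ x {L} → Halvings (length x) L →
    initial (x ∷ []) ↝[ setUpTime (length x) (suc L) ] lift (N.initial (x ∷ reciprocal (suc L * 4)))
  setUp x {L} h =
    ↝-≈ (refl , ≈-refl ∷ ≈-reflexive (fromCells-at (map bit x)) ∷ ≈*-refl)
      (recount (time x)
        (copying x [] ▷
         swept refl (left-at (os X)) (left-at (xs X)) ▷
         -- The step out of `copy` has already written the 1 of the numerator and one 0 of the
         -- denominator, so the counts of zeros start at 0 and 1.
         turning X {i = 0} bits-R ▷
         retarget (cong (λ k → lift (N.initial (x ∷ reciprocal (4 + k)))) (ℕ.+-identityʳ (L * 4)))
           (halving {i = 0} R bits-R (subst (λ m → Halvings m L) (sym marks-R) h))))
    where
    X = map (_, true) x ʳ++ []
    R = X ʳ++ []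

    R≡ : R ≡ map (_, true) x
    R≡ = ʳ++-involutive (map (_, true) x)

    bits-R : map proj₁ R ≡ x
    bits-R = trans (cong (map proj₁) R≡) (trans (sym (map-∘ x)) (map-id x))

    marks-R : marks R ≡ length x
    marks-R = trans (cong marks R≡) (all-marked x)
      where
      all-marked : ∀ x → marks (map (_, true) x) ≡ length x
      all-marked []      = refl
      all-marked (_ ∷ x) = cong suc (all-marked x)

    time : ∀ x → length x + (1 + (3 + length x + setUpTime (length x) L)) ≡ setUpTime (length x) (suc L)
    time x = sym (ℕ.+-assoc (length x) (4 + length x) _)

-- The number of halvings

halvings : ∀ m → ∃[ L ] Halvings m L
halvings = <-rec _ go
  where
  go : ∀ m → (∀ {k} → k < m → ∃[ L ] Halvings k L) → ∃[ L ] Halvings m L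
  go zero    rec = 0 , zero
  go (suc m) rec with rec (ℕ.⌊n/2⌋<n m)
  ... | L , h = suc L , suc h

halvings-count : ∀ {m L} → Halvings m L → L ≤ m
halvings-count zero        = ℕ.z≤n
halvings-count (suc {m} h) = ℕ.≤-trans (ℕ.s≤s (halvings-count h)) (ℕ.⌊n/2⌋<n m)

m≤1+2*⌊m/2⌋ : ∀ m → m ≤ 1 + 2 * ⌊ m /2⌋
m≤1+2*⌊m/2⌋ zero          = ℕ.z≤n
m≤1+2*⌊m/2⌋ (suc zero)    = ℕ.s≤s ℕ.z≤n
m≤1+2*⌊m/2⌋ (suc (suc m)) = begin
  2 + m                   ≤⟨ ℕ.+-monoʳ-≤ 2 (m≤1+2*⌊m/2⌋ m) ⟩
  1 + (2 + 2 * ⌊ m /2⌋)   ≡⟨ cong suc (ℕ.*-suc 2 ⌊ m /2⌋) ⟨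
  1 + 2 * suc ⌊ m /2⌋     ∎
  where open ℕ.≤-Reasoning

2*⌊m/2⌋≤m : ∀ m → 2 * ⌊ m /2⌋ ≤ m
2*⌊m/2⌋≤m zero          = ℕ.z≤n
2*⌊m/2⌋≤m (suc zero)    = ℕ.z≤n
2*⌊m/2⌋≤m (suc (suc m)) = begin
  2 * suc ⌊ m /2⌋   ≡⟨ ℕ.*-suc 2 ⌊ m /2⌋ ⟩
  2 + 2 * ⌊ m /2⌋   ≤⟨ ℕ.+-monoʳ-≤ 2 (2*⌊m/2⌋≤m m) ⟩
  2 + m             ∎
  where open ℕ.≤-Reasoning

-- Halving discards at most a remainder of 1, so going back one round at most doubles the strict
-- bound.
m<2^L : ∀ {m L} → Halvings m L → m < 2 ^ L
m<2^L zero                = ℕ.s≤s ℕ.z≤n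
m<2^L (suc {m} {L = L} h) = begin
  2 + m                     ≤⟨ ℕ.s≤s (m≤1+2*⌊m/2⌋ (suc m)) ⟩
  2 + 2 * ⌊ suc m /2⌋       ≡⟨ ℕ.*-suc 2 ⌊ suc m /2⌋ ⟨
  2 * suc ⌊ suc m /2⌋       ≤⟨ ℕ.*-monoʳ-≤ 2 (m<2^L h) ⟩
  2 * 2 ^ L                 ∎
  where open ℕ.≤-Reasoning

-- The bound fails at 0, so the induction ends at the last positive value, where `L` is 1.
2^L≤2*m : ∀ {m L} → Halvings (suc m) L → 2 ^ L ≤ 2 * suc m
2^L≤2*m (suc {m} h) with ⌊ suc m /2⌋ in eq | h
... | zero  | zero = ℕ.*-monoʳ-≤ 2 (ℕ.s≤s ℕ.z≤n)
... | suc k | h′@(suc {L = L} _) = ℕ.*-monoʳ-≤ 2 (begin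
  2 ^ suc L         ≤⟨ 2^L≤2*m h′ ⟩
  2 * suc k         ≡⟨ cong (2 *_) eq ⟨
  2 * ⌊ suc m /2⌋   ≤⟨ 2*⌊m/2⌋≤m (suc m) ⟩
  suc m             ∎)
  where open ℕ.≤-Reasoning

2^L≤2*[1+m] : ∀ {m L} → Halvings m L → 2 ^ L ≤ 2 * suc m
2^L≤2*[1+m] zero        = ℕ.s≤s ℕ.z≤n
2^L≤2*[1+m] h@(suc {m} _) = ℕ.≤-trans (2^L≤2*m h) (ℕ.*-monoʳ-≤ 2 (ℕ.n≤1+n (suc m)))

-- Natural numbers as rationals

ι : ℕ → ℚ
ι n = + n ℚ./ 1

ι≡ : ∀ n → ι n ≡ mkℚ (+ n) 0 (coprime-sym (1-coprimeTo n))
ι≡ n = ℚ.normalize-coprime (coprime-sym (1-coprimeTo n))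

ι-nonNeg : ∀ n → ℚ.NonNegative (ι n)
ι-nonNeg n = ℚ.normalize-nonNeg n 1

ι-pos : ∀ n .{{_ : ℕ.NonZero n}} → ℚ.Positive (ι n)
ι-pos n = ℚ.normalize-pos n 1

ι-+ : ∀ m n → ι (m + n) ≡ ι m ℚ.+ ι n
ι-+ m n rewrite ι≡ m | ι≡ n = cong (λ i → i ℚ./ 1) (begin
  + (m + n)                    ≡⟨ ℤ.pos-+ m n ⟩
  + m ℤ.+ + n                  ≡⟨ cong₂ ℤ._+_ (ℤ.*-identityʳ (+ m)) (ℤ.*-identityʳ (+ n)) ⟨
  + m ℤ.* + 1 ℤ.+ + n ℤ.* + 1  ∎)
  where open ≡-Reasoning

ι-* : ∀ m n → ι (m * n) ≡ ι m ℚ.* ι n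
ι-* m n rewrite ι≡ m | ι≡ n = cong (λ i → i ℚ./ 1) (ℤ.pos-* m n)

ι-mono : ∀ {m n} → m ≤ n → ι m ℚ.≤ ι n
ι-mono {m} {n} m≤n rewrite ι≡ m | ι≡ n =
  ℚ.*≤* (subst₂ ℤ._≤_ (sym (ℤ.*-identityʳ (+ m))) (sym (ℤ.*-identityʳ (+ n))) (ℤ.+≤+ m≤n))

ι-cancel : ∀ {m n} → ι m ℚ.≤ ι n → m ≤ n
ι-cancel {m} {n} le rewrite ι≡ m | ι≡ n =
  ℤ.drop‿+≤+ (subst₂ ℤ._≤_ (ℤ.*-identityʳ (+ m)) (ℤ.*-identityʳ (+ n)) (ℚ.drop-*≤* le))

-- Among unnormalised rationals, where no common factor is cancelled, this is a cross
-- multiplication.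
/*ι : ∀ n d .{{_ : ℕ.NonZero d}} → (+ n ℚ./ d) ℚ.* ι d ≡ ι n
/*ι n (suc d) = ℚ.toℚᵘ-injective (begin
  ℚ.toℚᵘ ((+ n ℚ./ suc d) ℚ.* ι (suc d))              ≈⟨ ℚ.toℚᵘ-homo-* (+ n ℚ./ suc d) (ι (suc d)) ⟩
  ℚ.toℚᵘ (+ n ℚ./ suc d) ℚᵘ.* ℚ.toℚᵘ (ι (suc d))      ≈⟨ ℚᵘ.*-cong (ℚ.toℚᵘ-fromℚᵘ p) (ℚ.toℚᵘ-fromℚᵘ q) ⟩
  p ℚᵘ.* q                                            ≈⟨ ℚᵘ.*≡* cross ⟩
  ℚᵘ.mkℚᵘ (+ n) 0                                     ≈⟨ ℚ.toℚᵘ-fromℚᵘ (ℚᵘ.mkℚᵘ (+ n) 0) ⟨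
  ℚ.toℚᵘ (ι n)                                        ∎)
  where
  open ℚᵘ.≃-Reasoning
  p = ℚᵘ.mkℚᵘ (+ n) d
  q = ℚᵘ.mkℚᵘ (+ suc d) 0
  cross : (+ n ℤ.* + suc d) ℤ.* + 1 ≡ + n ℤ.* + (suc d * 1)
  cross = trans (ℤ.*-identityʳ _) (cong (λ m → + n ℤ.* + m) (sym (ℕ.*-identityʳ (suc d))))

-- The parameter δ = 2^-k and its encoding

unit : ℕ → ℚ
unit d = mkℚ (+ 1) d (1-coprimeTo (suc d))

unit*ι : ∀ d → unit d ℚ.* ι (suc d) ≡ 1ℚ
unit*ι d = trans (cong (unit d ℚ.*_) (ι≡ (suc d))) (ℚ.*-inverseʳ (unit d))

suc-pred-2^ : ∀ k → suc (pred (2 ^ k)) ≡ 2 ^ k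
suc-pred-2^ k = ℕ.suc-pred (2 ^ k) {{ℕ.m^n≢0 2 k}}

-- `mkℚ` stores the denominator minus one, hence `pred`. Positivity of `k` gives δ < 1.
parameter : (k : ℕ) .{{_ : ℕ.NonZero k}} → Parameter
parameter k@(suc k′) = record
  { δ   = unit (pred (2 ^ k))
  ; 0<δ = ℚ.*<* (ℤ.+<+ (ℕ.s≤s ℕ.z≤n))
  ; δ<1 = ℚ.*<* (ℤ.+<+ (subst (2 ≤_) (sym (trans (ℕ.*-identityˡ _) (suc-pred-2^ k))) (ℕ.*-monoʳ-≤ 2 (ℕ.m^n>0 2 k′))))
  }

δ-parameter : ∀ k .{{_ : ℕ.NonZero k}} → δ (parameter k) ℚ.* ι (2 ^ k) ≡ 1ℚ
δ-parameter k@(suc _) =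
  trans (cong (λ q → unit (pred (2 ^ k)) ℚ.* ι q) (sym (suc-pred-2^ k))) (unit*ι (pred (2 ^ k)))

1/δ-parameter : ∀ k .{{_ : ℕ.NonZero k}} → 1/δ (parameter k) ≡ ι (2 ^ k)
1/δ-parameter k@(suc _) = trans (sym (ι≡ (suc (pred (2 ^ k))))) (cong ι (suc-pred-2^ k))

digits-0 : ∀ w → digits w 0 ≡ replicate w false
digits-0 zero    = refl
digits-0 (suc w) = trans (cong (_∷ʳ false) (digits-0 w)) (replicate-∷ʳ w)
  where
  replicate-∷ʳ : ∀ w → replicate w false ∷ʳ false ≡ false ∷ replicate w false
  replicate-∷ʳ zero    = refl
  replicate-∷ʳ (suc w) = cong (false ∷_) (replicate-∷ʳ w)

digits-1 : ∀ k → digits (suc k) 1 ≡ replicate k false ++ true ∷ []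
digits-1 k = cong (_∷ʳ true) (digits-0 k)

digits-2^ : ∀ k → digits (suc k) (2 ^ k) ≡ true ∷ replicate k false
digits-2^ zero    = refl
digits-2^ (suc k) = begin
  digits (suc k) (2 ^ suc k ℕ./ 2) ∷ʳ (2 ^ suc k ℕ.% 2 ℕ.≡ᵇ 1)
    ≡⟨ cong₂ (λ q r → digits (suc k) q ∷ʳ (r ℕ.≡ᵇ 1))
         (trans (cong (ℕ._/ 2) (ℕ.*-comm 2 (2 ^ k))) (ℕ.m*n/n≡m (2 ^ k) 2))
         (trans (cong (ℕ._% 2) (ℕ.*-comm 2 (2 ^ k))) (ℕ.m*n%n≡0 (2 ^ k) 2)) ⟩
  digits (suc k) (2 ^ k) ∷ʳ false
    ≡⟨ cong (_∷ʳ false) (digits-2^ k) ⟩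
  true ∷ (replicate k false ∷ʳ false)
    ≡⟨ cong (true ∷_) (trans (cong (_∷ʳ false) (sym (digits-0 k))) (digits-0 (suc k))) ⟩
  true ∷ replicate (suc k) false ∎
  where open ≡-Reasoning

-- The common width is `suc k`, the binary length of `2 ^ k`; the result is what the machine leaves
-- on the parameter tapes.
encode-parameter : ∀ k .{{_ : ℕ.NonZero k}} →
  encodeParameter (parameter k) ≡ (replicate k false ++ true ∷ []) ∷ (true ∷ replicate k false) ∷ []
encode-parameter k@(suc _) = begin
  encode (suc (pred (2 ^ k)))                  ≡⟨ cong encode (suc-pred-2^ k) ⟩
  encode (2 ^ k)                               ≡⟨ cong (λ w → digits (suc w) 1 ∷ digits (suc w) (2 ^ k) ∷ []) (⌊log₂[2^n]⌋≡n k) ⟩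
  digits (suc k) 1 ∷ digits (suc k) (2 ^ k) ∷ [] ≡⟨ cong₂ (λ p q → p ∷ q ∷ []) (digits-1 k) (digits-2^ k) ⟩
  _ ∎
  where
  open ≡-Reasoning
  encode : ℕ → Vec Str 2
  encode q = digits (suc ⌊log₂ q ⌋) 1 ∷ digits (suc ⌊log₂ q ⌋) q ∷ []

-- Time bounds as polynomials over the natural numbers

evalℕ : ∀ {v} → Poly v → Vec ℕ v → ℕ
evalℕ (con c) ρ = c
evalℕ (var i) ρ = Vec.lookup ρ i
evalℕ (p ⊕ q) ρ = evalℕ p ρ + evalℕ q ρ
evalℕ (p ⊗ q) ρ = evalℕ p ρ * evalℕ q ρ

eval-ι : ∀ {v} (p : Poly v) ρ → eval p (Vec.map ι ρ) ≡ ι (evalℕ p ρ)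
eval-ι (con c) ρ = refl
eval-ι (var i) ρ = lookup-map i ι ρ
eval-ι (p ⊕ q) ρ = trans (cong₂ ℚ._+_ (eval-ι p ρ) (eval-ι q ρ)) (sym (ι-+ (evalℕ p ρ) (evalℕ q ρ)))
eval-ι (p ⊗ q) ρ = trans (cong₂ ℚ._*_ (eval-ι p ρ) (eval-ι q ρ)) (sym (ι-* (evalℕ p ρ) (evalℕ q ρ)))

_[_] : ∀ {u v} → Poly u → (Fin u → Poly v) → Poly v
con c   [ σ ] = con c
var i   [ σ ] = σ i
(p ⊕ q) [ σ ] = (p [ σ ]) ⊕ (q [ σ ])
(p ⊗ q) [ σ ] = (p [ σ ]) ⊗ (q [ σ ])

-- The coefficients are natural numbers, so polynomials are monotone in every variable.
evalℕ-[] : ∀ {u v} (p : Poly u) (σ : Fin u → Poly v) {ρ ρ′} →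
  (∀ i → Vec.lookup ρ i ≤ evalℕ (σ i) ρ′) → evalℕ p ρ ≤ evalℕ (p [ σ ]) ρ′
evalℕ-[] (con c) σ le = ℕ.≤-refl
evalℕ-[] (var i) σ le = le i
evalℕ-[] (p ⊕ q) σ le = ℕ.+-mono-≤ (evalℕ-[] p σ le) (evalℕ-[] q σ le)
evalℕ-[] (p ⊗ q) σ le = ℕ.*-mono-≤ (evalℕ-[] p σ le) (evalℕ-[] q σ le)

-- From conditional probability to the proportion in one length

strings-length : ∀ n → All (λ x → length x ≡ n) (strings n)
strings-length zero    = refl ∷ []
strings-length (suc n) = ++⁺ (extend false) (extend true)
  where
  extend : ∀ b → All (λ x → length x ≡ suc n) (map (b ∷_) (strings n))
  extend b = map⁺ (All.map (cong suc) (strings-length n))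

filterᵇ-cong : ∀ {A : Set} {P Q : A → Bool} {zs} → All (λ z → P z ≡ Q z) zs → filterᵇ P zs ≡ filterᵇ Q zs
filterᵇ-cong                       []                 = refl
filterᵇ-cong {P = P} {Q} {z ∷ _} (Pz≡Qz ∷ rest) with P z | Q z
filterᵇ-cong (refl ∷ rest) | true  | _ = cong (_ ∷_) (filterᵇ-cong rest)
filterᵇ-cong (refl ∷ rest) | false | _ = filterᵇ-cong rest

filterᵇ-true : ∀ {A : Set} (zs : List A) → filterᵇ (const true) zs ≡ zs
filterᵇ-true []       = refl
filterᵇ-true (z ∷ zs) = cong (z ∷_) (filterᵇ-true zs)

sumℚ-++ : ∀ ps qs → sumℚ (ps ++ qs) ≡ sumℚ ps ℚ.+ sumℚ qs
sumℚ-++ []       qs = sym (ℚ.+-identityˡ (sumℚ qs))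
sumℚ-++ (p ∷ ps) qs = trans (cong (p ℚ.+_) (sumℚ-++ ps qs)) (sym (ℚ.+-assoc p (sumℚ ps) (sumℚ qs)))

weight : (Str → Bool) → List Str → ℚ
weight P zs = sumℚ (map μ̂ (filterᵇ P zs))

count : (Str → Bool) → ℕ → ℕ
count P n = length (filterᵇ P (strings n))

weight-++ : ∀ P ys zs → weight P (ys ++ zs) ≡ weight P ys ℚ.+ weight P zs
weight-++ P ys zs
  rewrite filter-++ (T? ∘ P) ys zs | map-++ μ̂ (filterᵇ P ys) (filterᵇ P zs)
  = sumℚ-++ (map μ̂ (filterᵇ P ys)) (map μ̂ (filterᵇ P zs))

weight-uniform : ∀ P {n} {zs} → All (λ z → length z ≡ n) zs →
  weight P zs ≡ ι (length (filterᵇ P zs)) ℚ.* lengthWeight n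
weight-uniform P {n} [] = sym (ℚ.*-zeroˡ (lengthWeight n))
weight-uniform P {n} {z ∷ zs} (refl ∷ rest) with P z
... | false = weight-uniform P rest
... | true  = begin
  w ℚ.+ weight P zs                        ≡⟨ cong₂ ℚ._+_ (sym (ℚ.*-identityˡ w)) (weight-uniform P rest) ⟩
  1ℚ ℚ.* w ℚ.+ ι k ℚ.* w                   ≡⟨ ℚ.*-distribʳ-+ w 1ℚ (ι k) ⟨
  (1ℚ ℚ.+ ι k) ℚ.* w                       ≡⟨ cong (ℚ._* w) (ι-+ 1 k) ⟨
  ι (suc k) ℚ.* w                          ∎
  where
  open ≡-Reasoning
  w = lengthWeight n
  k = length (filterᵇ P zs)

layer : ∀ P n → weight P (strings n) ≡ ι (count P n) ℚ.* lengthWeight n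
layer P n = weight-uniform P (strings-length n)

-- For positive `n`, the reciprocal of the weight of a single string of length `n`.
support : ℕ → ℕ
support n = n * suc n * 2 ^ n

lengthWeight-support : ∀ n .{{_ : ℕ.NonZero n}} → lengthWeight n ℚ.* ι (support n) ≡ 1ℚ
lengthWeight-support n@(suc _) = /*ι 1 (support n)
  where instance _ = ℕ.m*n≢0 (n * suc n) (2 ^ n) {{_}} {{ℕ.m^n≢0 2 n}}

lengthWeight-nonNeg : ∀ n → ℚ.NonNegative (lengthWeight n)
lengthWeight-nonNeg zero      = _
lengthWeight-nonNeg n@(suc _) = ℚ.normalize-nonNeg 1 (support n)
  where instance _ = ℕ.m*n≢0 (n * suc n) (2 ^ n) {{_}} {{ℕ.m^n≢0 2 n}}

layer-nonNeg : ∀ P n → 0ℚ ℚ.≤ weight P (strings n)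
layer-nonNeg P n rewrite layer P n =
  ℚ.nonNegative⁻¹ (ι (count P n) ℚ.* lengthWeight n)
    {{ℚ.nonNeg*nonNeg⇒nonNeg (ι (count P n)) {{ι-nonNeg (count P n)}} (lengthWeight n) {{lengthWeight-nonNeg n}}}}

-- Using 1 instead of the exact value 1 / (n (n + 1)) bounds the total weight up to length `n` by
-- `suc n`, which costs one factor `suc n` in the final estimate.
layer≤1 : ∀ n → weight (const true) (strings n) ℚ.≤ 1ℚ
layer≤1 zero      = ℚ.*≤* (ℤ.+≤+ ℕ.z≤n)
layer≤1 n@(suc _) = begin
  weight (const true) (strings n)                 ≡⟨ layer (const true) n ⟩
  ι (count (const true) n) ℚ.* lengthWeight n     ≤⟨ ℚ.*-monoʳ-≤-nonNeg (lengthWeight n) {{lengthWeight-nonNeg n}} (ι-mono count≤) ⟩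
  ι (support n) ℚ.* lengthWeight n                ≡⟨ ℚ.*-comm (ι (support n)) (lengthWeight n) ⟩
  lengthWeight n ℚ.* ι (support n)                ≡⟨ lengthWeight-support n ⟩
  1ℚ                                              ∎
  where
  open ℚ.≤-Reasoning
  count≤ : count (const true) n ≤ support n
  count≤ = subst (_≤ support n) (sym (trans (cong length (filterᵇ-true (strings n))) (length-strings n)))
                 (ℕ.m≤n*m (2 ^ n) (n * suc n))

weights-nonNeg : ∀ P ns → 0ℚ ℚ.≤ weight P (concatMap strings ns)
weights-nonNeg P []       = ℚ.≤-refl
weights-nonNeg P (n ∷ ns) rewrite weight-++ P (strings n) (concatMap strings ns) =
  ℚ.+-mono-≤ (layer-nonNeg P n) (weights-nonNeg P ns)

p≤p+q : ∀ {p q} → 0ℚ ℚ.≤ q → p ℚ.≤ p ℚ.+ q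
p≤p+q {p} {q} 0≤q = subst (ℚ._≤ p ℚ.+ q) (ℚ.+-identityʳ p) (ℚ.+-monoʳ-≤ p 0≤q)

p≤q+p : ∀ {p q} → 0ℚ ℚ.≤ q → p ℚ.≤ q ℚ.+ p
p≤q+p {p} {q} 0≤q = subst (ℚ._≤ q ℚ.+ p) (ℚ.+-identityˡ p) (ℚ.+-monoˡ-≤ p 0≤q)

layer≤weights : ∀ P {n ns} → n ∈ ns → weight P (strings n) ℚ.≤ weight P (concatMap strings ns)
layer≤weights P {n} {_ ∷ ns} (here refl) rewrite weight-++ P (strings n) (concatMap strings ns) =
  p≤p+q (weights-nonNeg P ns)
layer≤weights P {n} {k ∷ ns} (there n∈ns) rewrite weight-++ P (strings k) (concatMap strings ns) =
  ℚ.≤-trans (layer≤weights P n∈ns) (p≤q+p (layer-nonNeg P k))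

weights≤length : ∀ ns → weight (const true) (concatMap strings ns) ℚ.≤ ι (length ns)
weights≤length []       = ℚ.≤-refl
weights≤length (n ∷ ns) rewrite weight-++ (const true) (strings n) (concatMap strings ns) =
  ℚ.≤-trans (ℚ.+-mono-≤ (layer≤1 n) (weights≤length ns)) (ℚ.≤-reflexive (sym (ι-+ 1 (length ns))))

-- The strings of length `n` carry at most the weight of `P` up to length `n`, which is the
-- probability times the total weight; that total is at most 1 for each of the `suc n` lengths.
Prob≤⇒weight≤ : ∀ P n .{{_ : ℕ.NonZero n}} .{{_ : ℚ.NonZero (total≤ μ̂ n)}} δ → 0ℚ ℚ.≤ δ →
  Prob≤ μ̂ n P ℚ.≤ δ → weight P (strings n) ℚ.≤ δ ℚ.* ι (suc n)
Prob≤⇒weight≤ P n δ 0≤δ Prob≤δ = begin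
  weight P (strings n)            ≤⟨ layer≤weights P (∈-upTo⁺ (ℕ.n<1+n n)) ⟩
  W                               ≡⟨ ℚ.*-identityʳ W ⟨
  W ℚ.* 1ℚ                        ≡⟨ cong (W ℚ.*_) (ℚ.*-inverseˡ T) ⟨
  W ℚ.* (ℚ.1/ T ℚ.* T)            ≡⟨ ℚ.*-assoc W (ℚ.1/ T) T ⟨
  Prob≤ μ̂ n P ℚ.* T               ≤⟨ ℚ.*-monoʳ-≤-nonNeg T {{ℚ.nonNegative (weights-nonNeg (const true) (upTo (suc n)))}} Prob≤δ ⟩
  δ ℚ.* T                         ≤⟨ ℚ.*-monoˡ-≤-nonNeg δ {{ℚ.nonNegative 0≤δ}} (weights≤length (upTo (suc n))) ⟩
  δ ℚ.* ι (length (upTo (suc n))) ≡⟨ cong (λ k → δ ℚ.* ι k) (length-upTo (suc n)) ⟩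
  δ ℚ.* ι (suc n)                 ∎
  where
  open ℚ.≤-Reasoning
  W T : ℚ
  W = weightOn≤ μ̂ n P
  T = total≤ μ̂ n

-- Multiplying by `support n` and `D` clears the weight of a string and δ, and leaves an inequality
-- between natural numbers.
count*D≤ : ∀ P n D δ .{{_ : ℕ.NonZero n}} → δ ℚ.* ι D ≡ 1ℚ →
  weight P (strings n) ℚ.≤ δ ℚ.* ι (suc n) → count P n * D ≤ suc n * support n
count*D≤ P n D δ δD≡1 le = ι-cancel (begin
  ι (c * D)                                     ≡⟨ ι-* c D ⟩
  ι c ℚ.* ι D                                   ≡⟨ cong (ℚ._* ι D) (ℚ.*-identityʳ (ι c)) ⟨
  ι c ℚ.* 1ℚ ℚ.* ι D                            ≡⟨ cong (λ p → ι c ℚ.* p ℚ.* ι D) (lengthWeight-support n) ⟨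
  ι c ℚ.* (w ℚ.* ι S) ℚ.* ι D                   ≡⟨ regroup (ι c) w (ι S) (ι D) ⟩
  (ι c ℚ.* w) ℚ.* (ι S ℚ.* ι D)                 ≡⟨ cong (ℚ._* (ι S ℚ.* ι D)) (layer P n) ⟨
  weight P (strings n) ℚ.* (ι S ℚ.* ι D)        ≤⟨ ℚ.*-monoʳ-≤-nonNeg (ι S ℚ.* ι D) {{SD-nonNeg}} le ⟩
  (δ ℚ.* ι (suc n)) ℚ.* (ι S ℚ.* ι D)           ≡⟨ regroup′ δ (ι (suc n)) (ι S) (ι D) ⟩
  (δ ℚ.* ι D) ℚ.* (ι (suc n) ℚ.* ι S)           ≡⟨ cong (ℚ._* (ι (suc n) ℚ.* ι S)) δD≡1 ⟩
  1ℚ ℚ.* (ι (suc n) ℚ.* ι S)                    ≡⟨ ℚ.*-identityˡ _ ⟩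
  ι (suc n) ℚ.* ι S                             ≡⟨ ι-* (suc n) S ⟨
  ι (suc n * S)                                 ∎)
  where
  open ℚ.≤-Reasoning
  open ℚ-Solver
  c = count P n
  w = lengthWeight n
  S = support n
  SD-nonNeg = ℚ.nonNeg*nonNeg⇒nonNeg (ι S) {{ι-nonNeg S}} (ι D) {{ι-nonNeg D}}

  regroup : ∀ c w s d → c ℚ.* (w ℚ.* s) ℚ.* d ≡ (c ℚ.* w) ℚ.* (s ℚ.* d)
  regroup = solve 4 (λ c w s d → c :* (w :* s) :* d := (c :* w) :* (s :* d)) refl

  regroup′ : ∀ e m s d → (e ℚ.* m) ℚ.* (s ℚ.* d) ≡ (e ℚ.* d) ℚ.* (m ℚ.* s)
  regroup′ = solve 4 (λ e m s d → (e :* m) :* (s :* d) := (e :* d) :* (m :* s)) refl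

-- This is what the fourth power is for: three factors `suc n` absorb `suc n * (n * suc n)`, and the
-- remaining one makes the proportion tend to 0.
count*[1+n]≤2^n : ∀ c n D → suc n ^ 4 ≤ D → c * D ≤ suc n * support n → c * suc n ≤ 2 ^ n
count*[1+n]≤2^n c n D n⁴≤D le = ℕ.*-cancelʳ-≤ (c * s) (2 ^ n) (s ^ 3) {{ℕ.m^n≢0 s 3}} (begin
  c * s * s ^ 3             ≡⟨ ℕ.*-assoc c s (s ^ 3) ⟩
  c * s ^ 4                 ≤⟨ ℕ.*-monoʳ-≤ c n⁴≤D ⟩
  c * D                     ≤⟨ le ⟩
  s * (n * s * 2 ^ n)       ≤⟨ ℕ.*-monoʳ-≤ s (ℕ.*-monoˡ-≤ (2 ^ n) (ℕ.*-monoˡ-≤ s (ℕ.n≤1+n n))) ⟩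
  s * (s * s * 2 ^ n)       ≡⟨ solve 2 (λ s t → s :* (s :* s :* t) := t :* (s :* (s :* (s :* con 1)))) refl s (2 ^ n) ⟩
  2 ^ n * s ^ 3             ∎)
  where
  open ℕ.≤-Reasoning
  open +-*-Solver
  s = suc n

fraction≤unit : ∀ c n l .{{_ : ℕ.NonZero l}} → c * suc n ≤ l → (+ c ℚ./ l) ℚ.≤ unit n
fraction≤unit c n l le = ℚ.*-cancelʳ-≤-pos (ι (suc n * l)) {{ι-pos (suc n * l) {{ℕ.m*n≢0 (suc n) l}}}} (begin
  (+ c ℚ./ l) ℚ.* ι (suc n * l)             ≡⟨ cong (λ k → (+ c ℚ./ l) ℚ.* ι k) (ℕ.*-comm (suc n) l) ⟩
  (+ c ℚ./ l) ℚ.* ι (l * suc n)             ≡⟨ cong ((+ c ℚ./ l) ℚ.*_) (ι-* l (suc n)) ⟩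
  (+ c ℚ./ l) ℚ.* (ι l ℚ.* ι (suc n))       ≡⟨ ℚ.*-assoc (+ c ℚ./ l) (ι l) (ι (suc n)) ⟨
  (+ c ℚ./ l) ℚ.* ι l ℚ.* ι (suc n)         ≡⟨ cong (ℚ._* ι (suc n)) (/*ι c l) ⟩
  ι c ℚ.* ι (suc n)                         ≡⟨ ι-* c (suc n) ⟨
  ι (c * suc n)                             ≤⟨ ι-mono le ⟩
  ι l                                       ≡⟨ ℚ.*-identityˡ (ι l) ⟨
  1ℚ ℚ.* ι l                                ≡⟨ cong (ℚ._* ι l) (unit*ι n) ⟨
  unit n ℚ.* ι (suc n) ℚ.* ι l              ≡⟨ ℚ.*-assoc (unit n) (ι (suc n)) (ι l) ⟩
  unit n ℚ.* (ι (suc n) ℚ.* ι l)            ≡⟨ cong (unit n ℚ.*_) (ι-* (suc n) l) ⟨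
  unit n ℚ.* ι (suc n * l)                  ∎)
  where open ℚ.≤-Reasoning

-- A positive rational is at least the reciprocal of its denominator `suc e`, which therefore serves
-- as `N`.
unit<ε : ∀ {ε} → 0ℚ ℚ.< ε → ∃[ N ] ∀ n → N ≤ n → unit n ℚ.< ε
unit<ε {mkℚ +[1+ a ] e _}       0<ε = suc e , λ n e<n → ℚ.*<* (ℤ.+<+ (begin-strict
  1 * suc e       ≡⟨ ℕ.*-identityˡ (suc e) ⟩
  suc e           <⟨ ℕ.s≤s e<n ⟩
  suc n           ≤⟨ ℕ.m≤n*m (suc n) (suc a) ⟩
  suc a * suc n   ∎))
  where open ℕ.≤-Reasoning
unit<ε {mkℚ (+ 0) _ _}          (ℚ.*<* (ℤ.+<+ ()))
unit<ε {mkℚ (ℤ.-[1+ _ ]) _ _}   (ℚ.*<* ())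

-- The algorithm A′ and its running time

setUpTime≤ : ∀ n L → setUpTime n L ≤ suc L * (4 + (n + n))
setUpTime≤ n zero    = begin
  n + (2 + n)             ≤⟨ ℕ.+-monoʳ-≤ n (ℕ.+-monoˡ-≤ n (ℕ.m≤n+m 2 2)) ⟩
  n + (4 + n)             ≡⟨ solve 1 (λ n → n :+ (con 4 :+ n) := con 1 :* (con 4 :+ (n :+ n))) refl n ⟩
  1 * (4 + (n + n))       ∎
  where
  open ℕ.≤-Reasoning
  open +-*-Solver
setUpTime≤ n (suc L) = begin
  n + (4 + n) + setUpTime n L             ≤⟨ ℕ.+-monoʳ-≤ (n + (4 + n)) (setUpTime≤ n L) ⟩
  n + (4 + n) + suc L * (4 + (n + n))     ≡⟨ cong (_+ suc L * (4 + (n + n))) (solve 1 (λ n → n :+ (con 4 :+ n) := con 4 :+ (n :+ n)) refl n) ⟩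
  suc (suc L) * (4 + (n + n))             ∎
  where
  open ℕ.≤-Reasoning
  open +-*-Solver

verdict : Maybe Str → Str × Confidence
verdict nothing  = [] , maybe
verdict (just y) = y , definitely

encodeVerdict-verdict : ∀ r → encodeVerdict (verdict r) ≡ encodeBenign r
encodeVerdict-verdict nothing  = refl
encodeVerdict-verdict (just _) = refl

isMaybe-verdict : ∀ r → isMaybe (proj₂ (verdict r)) ≡ is-nothing r
isMaybe-verdict nothing  = refl
isMaybe-verdict (just _) = refl

halvingCount : ℕ → ℕ
halvingCount n = proj₁ (halvings n)

-- Opaque, so that `2 ^ exponent n` and the parameter built from it stay folded during type
-- checking.
opaque
  exponent : ℕ → ℕ
  exponent n = suc (halvingCount n) * 4

  exponent≡ : ∀ n → exponent n ≡ suc (halvingCount n) * 4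
  exponent≡ n = refl

  instance
    exponent≢0 : ∀ {n} → ℕ.NonZero (exponent n)
    exponent≢0 = _

[1+n]^4≤2^exponent : ∀ n → suc n ^ 4 ≤ 2 ^ exponent n
[1+n]^4≤2^exponent n = begin
  suc n ^ 4                       ≤⟨ ℕ.^-monoˡ-≤ 4 (ℕ.≤-trans (m<2^L (proj₂ (halvings n))) (ℕ.m≤n*m (2 ^ halvingCount n) 2)) ⟩
  (2 ^ suc (halvingCount n)) ^ 4  ≡⟨ ℕ.^-*-assoc 2 (suc (halvingCount n)) 4 ⟩
  2 ^ (suc (halvingCount n) * 4)  ≡⟨ cong (2 ^_) (exponent≡ n) ⟨
  2 ^ exponent n                  ∎
  where open ℕ.≤-Reasoning

-- Keeps 1/δ polynomial in the length, and with it the running time of the scheme.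
2^exponent≤[4*[1+n]]^4 : ∀ n → 2 ^ exponent n ≤ (4 * suc n) ^ 4
2^exponent≤[4*[1+n]]^4 n = begin
  2 ^ exponent n                  ≡⟨ cong (2 ^_) (exponent≡ n) ⟩
  2 ^ (suc (halvingCount n) * 4)  ≡⟨ ℕ.^-*-assoc 2 (suc (halvingCount n)) 4 ⟨
  (2 ^ suc (halvingCount n)) ^ 4  ≤⟨ ℕ.^-monoˡ-≤ 4 (ℕ.*-monoʳ-≤ 2 (2^L≤2*[1+m] (proj₂ (halvings n)))) ⟩
  (2 * (2 * suc n)) ^ 4           ≡⟨ cong (_^ 4) (ℕ.*-assoc 2 2 (suc n)) ⟨
  (4 * suc n) ^ 4                 ∎
  where open ℕ.≤-Reasoning

module _ (f : Str → Str) (A : Str → Parameter → Maybe Str) (scheme : PolyTimeBenignScheme f μ̂ A) where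
  open PolyTimeBenignScheme scheme

  d : ℕ → Parameter
  d n = parameter (exponent n)

  -- δ depends on the length alone, so a single instance of the scheme governs all strings of a
  -- given length.
  A′ : Str → Str × Confidence
  A′ x = verdict (A x (d (length x)))

  selfKnowing : SelfKnowinglyCorrect f A′
  selfKnowing x t eq with A x (d (length x)) in Ax
  selfKnowing x t refl | just _ = sym (BenignFaults.correct (benign (d (length x))) x t Ax)

  maybeFraction≤ : ∀ n .{{_ : ℕ.NonZero n}} → maybeFraction A′ n ℚ.≤ unit n
  maybeFraction≤ n {{n≢0}} =
    fraction≤unit (count (isMaybe ∘ proj₂ ∘ A′) n) n (length (strings n)) {{strings-nonEmpty n}}
      (subst₂ (λ c l → c * suc n ≤ l) (sym same-count) (sym (length-strings n))
        (count*[1+n]≤2^n (count P n) n (2 ^ exponent n) ([1+n]^4≤2^exponent n)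
          (count*D≤ P n (2 ^ exponent n) (δ (d n)) (δ-parameter (exponent n))
            (Prob≤⇒weight≤ P n {{n≢0}} {{total≢0}} (δ (d n)) (ℚ.<⇒≤ (Parameter.0<δ (d n))) (rarely? (d n) n {{n≢0}} {{total≢0}})))))
    where
    P : Str → Bool
    P x = is-nothing (A x (d n))

    total≢0 : ℚ.NonZero (total≤ μ̂ n)
    total≢0 = ℚ.pos⇒nonZero (total≤ μ̂ n) {{total≤-μ̂ n}}

    same : ∀ x → length x ≡ n → isMaybe (proj₂ (A′ x)) ≡ P x
    same x refl = isMaybe-verdict (A x (d n))

    same-count : count (isMaybe ∘ proj₂ ∘ A′) n ≡ count P n
    same-count = cong length (filterᵇ-cong {P = isMaybe ∘ proj₂ ∘ A′} {Q = P} (All.map (λ {x} → same x) (strings-length n)))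

  frequently : maybeFraction A′ ⟶ 0ℚ
  frequently ε 0<ε with unit<ε 0<ε
  -- The successor ensures that `n` is positive, as `maybeFraction≤` requires.
  ... | N , small = suc N , λ n N<n → subst (ℚ._< ε) (sym (∣fraction∣ n))
    (ℚ.≤-<-trans (maybeFraction≤ n {{ℕ.>-nonZero (ℕ.m<n⇒0<n N<n)}}) (small n (ℕ.<⇒≤ N<n)))
    where
    fraction-nonNeg : ∀ n → ℚ.NonNegative (maybeFraction A′ n)
    fraction-nonNeg n =
      ℚ.normalize-nonNeg (count (isMaybe ∘ proj₂ ∘ A′) n) (length (strings n)) {{strings-nonEmpty n}}

    ∣fraction∣ : ∀ n → ℚ.∣ maybeFraction A′ n ℚ.- 0ℚ ∣ ≡ maybeFraction A′ n
    ∣fraction∣ n = trans (cong ℚ.∣_∣ (ℚ.+-identityʳ (maybeFraction A′ n)))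
                         (ℚ.0≤p⇒∣p∣≡p (ℚ.nonNegative⁻¹ (maybeFraction A′ n) {{fraction-nonNeg n}}))

  open Wrapper machine using (⇓-lift; setUp; reciprocal) renaming (machine to machine′)
  open Machine machine using (initial; _⇓[_]_)
  open Machine machine′ using () renaming (initial to initial′; _⇓[_]_ to _⇓′[_]_)
  open Run machine′ using (_▷⇓_)

  size scale : Poly 1
  size  = var zero
  scale = con 4 ⊗ (con 1 ⊕ size)

  -- Substitutes for |x| and 1/δ. The final `con 1` makes the value agree with `(4 * suc n) ^ 4` by
  -- computation.
  bounds : Fin 2 → Poly 1
  bounds zero       = size
  bounds (suc zero) = scale ⊗ (scale ⊗ (scale ⊗ (scale ⊗ con 1)))

  -- The first summand is the set-up: at most `2 + n` sweeps there and back, since the number of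
  -- halvings is at most `n`.
  time : Poly 1
  time = ((con 2 ⊕ size) ⊗ (con 4 ⊕ (size ⊕ size))) ⊕ (timeBound [ bounds ])

  encode-d : ∀ n → encodeParameter (d n) ≡ reciprocal (suc (halvingCount n) * 4)
  encode-d n = trans (encode-parameter (exponent n)) (cong reciprocal (exponent≡ n))

  setUp-bound : ∀ n → setUpTime n (suc (halvingCount n)) ≤ (2 + n) * (4 + (n + n))
  setUp-bound n = ℕ.≤-trans (setUpTime≤ n (suc (halvingCount n)))
    (ℕ.*-monoˡ-≤ (4 + (n + n)) (ℕ.+-monoʳ-≤ 2 (halvings-count (proj₂ (halvings n)))))

  run-bound : ∀ n t → ι t ℚ.≤ eval timeBound (ι n ∷ 1/δ (d n) ∷ []) → t ≤ evalℕ (timeBound [ bounds ]) (n ∷ [])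
  run-bound n t t≤ = ℕ.≤-trans
    (ι-cancel (ℚ.≤-trans t≤ (ℚ.≤-reflexive
      (trans (cong (λ q → eval timeBound (ι n ∷ q ∷ [])) (1/δ-parameter (exponent n)))
             (eval-ι timeBound (n ∷ 2 ^ exponent n ∷ []))))))
    (evalℕ-[] timeBound bounds λ
      { zero       → ℕ.≤-refl
      ; (suc zero) → 2^exponent≤[4*[1+n]]^4 n })

  run′ : ∀ x t → initial (x ∷ encodeParameter (d (length x))) ⇓[ t ] encodeBenign (A x (d (length x))) →
    initial′ (x ∷ []) ⇓′[ setUpTime (length x) (suc (halvingCount (length x))) + t ] encodeVerdict (A′ x)
  run′ x t run⇓ =
    subst (initial′ (x ∷ []) ⇓′[ setUpTime (length x) (suc (halvingCount (length x))) + t ]_)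
      (sym (encodeVerdict-verdict (A x (d (length x)))))
      (setUp x (proj₂ (halvings (length x))) ▷⇓
        ⇓-lift (subst (λ e → initial (x ∷ e) ⇓[ t ] encodeBenign (A x (d (length x)))) (encode-d (length x)) run⇓))

  runs′ : ∀ x → OutputsWithin machine′ (x ∷ []) (encodeVerdict (A′ x)) (eval time (∣ x ∣ℚ ∷ []))
  runs′ x with runs x (d (length x))
  ... | t , run⇓ , t≤ =
    setUpTime (length x) (suc (halvingCount (length x))) + t ,
    run′ x t run⇓ ,
    ℚ.≤-trans (ι-mono (ℕ.+-mono-≤ (setUp-bound (length x)) (run-bound (length x) t t≤)))
              (ℚ.≤-reflexive (sym (eval-ι time (length x ∷ []))))

theorem2p1 : (f : Str → Str) (A : Str → Parameter → Maybe Str) →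
    PolyTimeBenignScheme f μ̂ A →
    ∃[ A′ ] FrequentlySelfKnowinglyCorrect f A′ × PolyTime A′
theorem2p1 f A scheme =
  A′ f A scheme ,
  record { selfKnowing = selfKnowing f A scheme ; frequently = frequently f A scheme } ,
  record
    { machine   = Wrapper.machine (PolyTimeBenignScheme.machine scheme)
    ; timeBound = time f A scheme
    ; runs      = runs′ f A scheme
    }
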